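{- Let $\mathcal{S}$ be a structural abstract logic which is both uniform and couniform in a propositional language $\mathcal{L}$ with $\mathrm{card}(\mathcal{V}_{\mathcal{L}})\ge\aleph_0$, and let $\mathcal{L}^{+}$ be a primitive extension of $\mathcal{L}$. Then $\mathcal{S}$ and $(\mathcal{S})^{+}$ are determined by one and the same atlas which is both uniform and couniform.
   Context: A propositional language $\mathcal{L}$ has a set $\mathcal{V}_{\mathcal{L}}$ of variables, a set $\mathcal{C}_{\mathcal{L}}$ of constants and a set $\mathcal{F}_{\mathcal{L}}$ of finitary connectives. $\mathbf{Fm}_{\mathcal{L}}$ is the set of all $\mathcal{L}$-formulae; $\mathcal{V}(\alpha)$ is the set of variables occurring in $\alpha$, and $\mathcal{V}(X)=\bigcup_{\alpha\in X}\mathcal{V}(\alpha)$ for a set $X$ of formulae. For $\mathcal{V}\subseteq\mathcal{V}_{\mathcal{L}}$, $\mathbf{Fm}_{\mathcal{L}}[\mathcal{V}]=\{\alpha\in\mathbf{Fm}_{\mathcal{L}} : \mathcal{V}(\alpha)\subseteq\mathcal{V}\}$. $\mathcal{L}^{+}$ is a primitive extension of $\mathcal{L}$ if $\mathcal{C}_{\mathcal{L}}\cup\mathcal{F}_{\mathcal{L}}=\mathcal{C}_{\mathcal{L}^{+}}\cup\mathcal{F}_{\mathcal{L}^{+}}$ and $\mathcal{V}_{\mathcal{L}}\subseteq\mathcal{V}_{\mathcal{L}^{+}}$. A structural abstract logic $\mathcal{S}$ in $\mathcal{L}$ is given by a (not necessarily finitary) consequence relation $\vdash_{\mathcal{S}}$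 on $\mathbf{Fm}_{\mathcal{L}}$ (reflexive, monotone, closed under cut) that is closed under substitutions; $\mathbf{Cn}_{\mathcal{S}}(X)=\{\alpha : X\vdash_{\mathcal{S}}\alpha\}$, and $X$ is consistent if $\mathbf{Cn}_{\mathcal{S}}(X)\neq\mathbf{Fm}_{\mathcal{L}}$. - $\mathcal{S}$ is uniform if for all $X,Y\subseteq\mathbf{Fm}_{\mathcal{L}}$ and $\alpha\in\mathbf{Fm}_{\mathcal{L}}$ with $\mathcal{V}(X\cup\{\alpha\})\cap\mathcal{V}(Y)=\varnothing$ and $Y$ consistent: $X\cup Y\vdash_{\mathcal{S}}\alpha$ implies $X\vdash_{\mathcal{S}}\alpha$. - $\mathcal{S}$ is couniform if for any collection $\{X_i\}_{i\in I}$ of formula sets with $\mathcal{V}(X_i)\cap\mathcal{V}(X_{j})=\varnothing$ for $i\neq j$ and $\mathcal{V}(\bigcup_{i\in I}X_i)\neq\mathcal{V}_{\mathcal{L}}$: if $\bigcup_{i\in I}X_i$ is inconsistent, then at least one $X_i$ is inconsistent. The Wójcicki logic $(\mathcal{S})^{+}$ in $\mathcal{L}^{+}$ is given by the relation: for $X\cup\{\alpha\}\subseteq\mathbf{Fm}_{\mathcal{L}^{+}}$, $X\vdash_{(\mathcal{S})^{+}}\alpha$ iff there are a set $Y\cup\{\beta\}\subseteq\mathbf{Fm}_{\mathcal{L}}$ and an $\mathcal{L}^{+}$-substitution $\sigma$ such that $\sigma(Y)\subseteq X$, $\alpha=\sigma(\beta)$ and $Y\vdash_{\mathcal{S}}\beta$.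 An $\mathcal{L}$-matrix is a pair $\mathbf{M}=\langle\mathbf{A},D\rangle$ with $\mathbf{A}$ an algebra of the signature of $\mathcal{L}$ and $D\subseteq|\mathbf{A}|$ (its logical filter). An atlas is a pair $\langle\mathbf{A},\{D_i\}_{i\in I}\rangle$ with $I\neq\varnothing$ and each $D_i\subseteq|\mathbf{A}|$; put $\mathbf{M}_i=\langle\mathbf{A},D_i\rangle$. An abstract logic in a given language is determined by an atlas if its consequence relation coincides with the matrix consequence in that language relative to the atlas: $\alpha$ follows from $X$ iff for every $i\in I$ and every valuation $v$ of the formulae of that language in $\mathbf{A}$ (homomorphism from the formula algebra to $\mathbf{A}$), $v[X]\subseteq D_i$ implies $v[\alpha]\in D_i$. The following notions are defined with respect to a language $\mathcal{L}$. $\mathfrak{S}(\mathbf{M}_i)$ is the collection of all sets of the form $\{\alpha\in\mathbf{Fm}_{\mathcal{L}} : v[\alpha]\in D_i\}$, with $v$ an $\mathcal{L}$-valuation in $\mathbf{A}$. The atlas is uniform if for all $X,Y\subseteq\mathbf{Fm}_{\mathcal{L}}$ with $X\subseteq\mathbf{Fm}_{\mathcal{L}}[\mathcal{V}_{\mathcal{L}}\setminus\mathcal{V}(Y)]$, all $i,j\in I$, all $Z_i\in\mathfrak{S}(\mathbf{M}_i)$ and $Z_j\in\mathfrak{S}(\mathbf{M}_j)$, there are $k\in I$ and $Z_k\in\mathfrak{S}(\mathbf{M}_k)$ such that: if $X\subseteq Z_i$ and $Y\subseteq Z_j\subsetneq\mathbf{Fm}_{\mathcal{L}}$, then $Z_i\cap\mathbf{Fm}_{\mathcal{L}}[\mathcal{V}_{\mathcal{L}}\setminus\mathcal{V}(Y)]=Z_k\cap\mathbf{Fm}_{\mathcal{L}}[\mathcal{V}_{\mathcal{L}}\setminus\mathcal{V}(Y)]$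 and $Z_j\cap\mathbf{Fm}_{\mathcal{L}}[\mathcal{V}(Y)]\subseteq Z_k$. The atlas is couniform if for any collection $\{X_t\}_{t\in T}$ of subsets of $\mathbf{Fm}_{\mathcal{L}}$ with $\mathcal{V}(X_t)\cap\mathcal{V}(X_{t'})=\varnothing$ for $t\neq t'$ and $\mathcal{V}(\bigcup_{t\in T}X_t)\neq\mathcal{V}_{\mathcal{L}}$: if for every $t\in T$ there are $j\in I$ and $Z_j\in\mathfrak{S}(\mathbf{M}_j)$ with $X_t\subseteq Z_j\subsetneq\mathbf{Fm}_{\mathcal{L}}$, then there are $k\in I$ and $Z_k\in\mathfrak{S}(\mathbf{M}_k)$ with $\bigcup_{t\in T}X_t\subseteq Z_k\subsetneq\mathbf{Fm}_{\mathcal{L}}$.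
   Formalization: It is assumed that the relation defining the Wójcicki logic (S)⁺ really is a consequence relation (closed under cut); this can fail when L has more connectives than variables, and then no atlas can determine (S)⁺. -}

module Defs where

open import Level using (Level; suc; _⊔_)
open import Data.Nat.Base using (ℕ)
open import Data.Product using (Σ-syntax; ∃-syntax; _×_)
open import Data.Vec.Base as Vec using (Vec; []; _∷_)
open import Data.Vec.Relation.Unary.Any using (Any)
open import Function.Base using (_∘_)
open import Function.Bundles using (_↣_; _⇔_; module Injection)
open import Relation.Binary.PropositionalEquality using (_≡_; _≢_)
open import Relation.Nullary.Negation using (¬_)
open import Relation.Unary
  using (Pred; _∈_; _⊆_; _⊂_; _≐_; _∪_; _∩_; _⊥_; ∁; U; ｛_｝; ⋃; Universal)

-- "Set" is read as `Set ℓ` for a fixed universe level ℓ, subsets are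
-- predicates at level ℓ, and equality of subsets is extensional (_≐_).

private
  variable
    ℓ a b : Level

record Signature (ℓ : Level) : Set (suc ℓ) where
  field
    Const : Set ℓ
    Conn  : Set ℓ
    arity : Conn → ℕ

record Language (ℓ : Level) : Set (suc ℓ) where
  field
    signature : Signature ℓ
    Var       : Set ℓ
  open Signature signature public

open Language public using (signature; Var)

data Fm (L : Language ℓ) : Set ℓ where
  var   : Var L → Fm L
  const : Language.Const L → Fm L
  conn  : (f : Language.Conn L) → Vec (Fm L) (Language.arity L f) → Fm L

data _occursIn_ {L : Language ℓ} (x : Var L) : Fm L → Set ℓ where
  here   : x occursIn var x
  inside : ∀ {f ts} → Any (x occursIn_) ts → x occursIn conn f ts

𝒫Fm : Language ℓ → Set (suc ℓ)
𝒫Fm {ℓ} L = Pred (Fm L) ℓ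

𝒱 : {L : Language ℓ} → 𝒫Fm L → Pred (Var L) ℓ
𝒱 X x = ∃[ α ] (α ∈ X × x occursIn α)

Fm[_] : {L : Language ℓ} → Pred (Var L) ℓ → 𝒫Fm L
Fm[ W ] α = ∀ {x} → x occursIn α → x ∈ W

image : {A : Set a} {B : Set b} → (A → B) → Pred A a → Pred B (a ⊔ b)
image f X y = ∃[ x ] (x ∈ X × y ≡ f x)

-- The symbols are the same and V_L ⊆ V_{L⁺}, the inclusion being rendered as
-- an injection.
record PrimitiveExtension (L : Language ℓ) : Set (suc ℓ) where
  field
    Var⁺    : Set ℓ
    include : Var L ↣ Var⁺

  language : Language ℓ
  language = record { signature = signature L ; Var = Var⁺ }

  embed  : Fm L → Fm language
  embeds : ∀ {n} → Vec (Fm L) n → Vec (Fm language) n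
  embed (var x)     = var (Injection.to include x)
  embed (const c)   = const c
  embed (conn f ts) = conn f (embeds ts)
  embeds []         = []
  embeds (t ∷ ts)   = embed t ∷ embeds ts

record Algebra (Sg : Signature ℓ) : Set (suc ℓ) where
  open Signature Sg
  field
    Carrier : Set ℓ
    ⟦const⟧ : Const → Carrier
    ⟦conn⟧  : (f : Conn) → Vec Carrier (arity f) → Carrier

open Algebra public using (Carrier)

formulaAlgebra : (L : Language ℓ) → Algebra (signature L)
formulaAlgebra L = record { Carrier = Fm L ; ⟦const⟧ = const ; ⟦conn⟧ = conn }

record Valuation (L : Language ℓ) (𝑨 : Algebra (signature L)) : Set ℓ where
  open Algebra 𝑨 using (⟦const⟧; ⟦conn⟧)
  field
    ⟨_⟩        : Fm L → Carrier 𝑨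
    const-homo : ∀ c → ⟨ const c ⟩ ≡ ⟦const⟧ c
    conn-homo  : ∀ f ts → ⟨ conn f ts ⟩ ≡ ⟦conn⟧ f (Vec.map ⟨_⟩ ts)

open Valuation public using (⟨_⟩)

Substitution : Language ℓ → Set ℓ
Substitution L = Valuation L (formulaAlgebra L)

------------------------------------------------------------------------
-- Abstract logics

record AbstractLogic (L : Language ℓ) : Set (suc (suc ℓ)) where
  infix 4 _⊢_
  field
    _⊢_       : 𝒫Fm L → Fm L → Set (suc ℓ)
    reflexive : ∀ {X : 𝒫Fm L} {α} → α ∈ X → X ⊢ α
    monotone  : ∀ {X Y : 𝒫Fm L} {α} → X ⊆ Y → X ⊢ α → Y ⊢ α
    cut       : ∀ {X Y : 𝒫Fm L} {α} → (∀ {β} → β ∈ Y → X ⊢ β) → X ∪ Y ⊢ α → X ⊢ α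

module _ {L : Language ℓ} (𝓢 : AbstractLogic L) where
  open AbstractLogic 𝓢

  Structural : Set (suc ℓ)
  Structural = ∀ (σ : Substitution L) {X : 𝒫Fm L} {α} → X ⊢ α → image ⟨ σ ⟩ X ⊢ ⟨ σ ⟩ α

  Cn : 𝒫Fm L → Pred (Fm L) (suc ℓ)
  Cn X α = X ⊢ α

  Inconsistent : 𝒫Fm L → Set (suc ℓ)
  Inconsistent X = Universal (Cn X)

  Consistent : 𝒫Fm L → Set (suc ℓ)
  Consistent X = ¬ Inconsistent X

  Uniform : Set (suc ℓ)
  Uniform = ∀ (X Y : 𝒫Fm L) (α : Fm L) →
    𝒱 (X ∪ ｛ α ｝) ⊥ 𝒱 Y → Consistent Y → X ∪ Y ⊢ α → X ⊢ α

  -- The index set may be empty, so couniformity entails that ∅ is consistent.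
  Couniform : Set (suc ℓ)
  Couniform = ∀ (T : Set ℓ) (X : T → 𝒫Fm L) →
    (∀ t t′ → t ≢ t′ → 𝒱 (X t) ⊥ 𝒱 (X t′)) →
    ¬ Universal (𝒱 (⋃ T X)) →
    Inconsistent (⋃ T X) → ∃[ t ] Inconsistent (X t)

module _ {L : Language ℓ} (𝓢 : AbstractLogic L) (E : PrimitiveExtension L) where
  open AbstractLogic 𝓢
  open PrimitiveExtension E using (embed) renaming (language to L⁺)

  WójcickiRelation : 𝒫Fm L⁺ → Fm L⁺ → Set (suc ℓ)
  WójcickiRelation X α =
    Σ[ Y ∈ 𝒫Fm L ] Σ[ β ∈ Fm L ] Σ[ σ ∈ Substitution L⁺ ]
      (image (⟨ σ ⟩ ∘ embed) Y ⊆ X × α ≡ ⟨ σ ⟩ (embed β) × Y ⊢ β)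

  -- The abstract logic given by the relation above. The relation is always
  -- reflexive and monotone, but the cut rule can fail when L has more
  -- connectives than variables, in which case there is no such logic.
  IsWójcickiLogic : AbstractLogic L⁺ → Set (suc ℓ)
  IsWójcickiLogic 𝓢⁺ = ∀ X α → Cn 𝓢⁺ X α ⇔ WójcickiRelation X α

------------------------------------------------------------------------
-- Atlases

record Atlas (Sg : Signature ℓ) : Set (suc ℓ) where
  field
    algebra   : Algebra Sg
    I         : Set ℓ
    inhabited : I
    D         : I → Pred (Carrier algebra) ℓ

-- An atlas depends only on the signature, so the same atlas can be read in
-- any language L over that signature.
module _ (L : Language ℓ) (𝔸 : Atlas (signature L)) where
  open Atlas 𝔸

  _⊨_ : 𝒫Fm L → Fm L → Set ℓ
  X ⊨ α = ∀ (i : I) (v : Valuation L algebra) →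
    image ⟨ v ⟩ X ⊆ D i → ⟨ v ⟩ α ∈ D i

  Determines : AbstractLogic L → Set (suc ℓ)
  Determines 𝓢 = ∀ X α → Cn 𝓢 X α ⇔ X ⊨ α

  𝔖 : I → Pred (𝒫Fm L) ℓ
  𝔖 i Z = Σ[ v ∈ Valuation L algebra ] Z ≐ (λ α → ⟨ v ⟩ α ∈ D i)

  UniformAtlas : Set (suc ℓ)
  UniformAtlas = ∀ (X Y : 𝒫Fm L) → X ⊆ Fm[ ∁ (𝒱 Y) ] →
    ∀ (i j : I) (Zᵢ Zⱼ : 𝒫Fm L) → Zᵢ ∈ 𝔖 i → Zⱼ ∈ 𝔖 j →
    Σ[ k ∈ I ] Σ[ Zₖ ∈ 𝒫Fm L ] (Zₖ ∈ 𝔖 k ×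
      (X ⊆ Zᵢ → Y ⊆ Zⱼ → Zⱼ ⊂ U →
        ((Zᵢ ∩ Fm[ ∁ (𝒱 Y) ]) ≐ (Zₖ ∩ Fm[ ∁ (𝒱 Y) ])) ×
        ((Zⱼ ∩ Fm[ 𝒱 Y ]) ⊆ Zₖ)))

  CouniformAtlas : Set (suc ℓ)
  CouniformAtlas = ∀ (T : Set ℓ) (X : T → 𝒫Fm L) →
    (∀ t t′ → t ≢ t′ → 𝒱 (X t) ⊥ 𝒱 (X t′)) →
    ¬ Universal (𝒱 (⋃ T X)) →
    (∀ t → Σ[ j ∈ I ] Σ[ Zⱼ ∈ 𝒫Fm L ] (Zⱼ ∈ 𝔖 j × X t ⊆ Zⱼ × Zⱼ ⊂ U)) →
    Σ[ k ∈ I ] Σ[ Zₖ ∈ 𝒫Fm L ] (Zₖ ∈ 𝔖 k × ⋃ T X ⊆ Zₖ × Zₖ ⊂ U)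

{-# OPTIONS --safe #-}

-- The common atlas is the Lindenbaum atlas of (𝓢)⁺: the formula algebra of L⁺
-- with all theories of (𝓢)⁺.  The sets in 𝔖, read in L⁺ or in L, are then
-- exactly the theories of (𝓢)⁺ and of 𝓢 (the latter because (𝓢)⁺ is
-- conservative over 𝓢), so uniformity and couniformity of the atlas reduce to
-- those of the two logics.
--
-- To carry them from 𝓢 to (𝓢)⁺, let Z ⊢ β in 𝓢 witness σ(Z) ⊢ σ(β) in (𝓢)⁺.
-- Replace every variable x with σ(x) variable-free by σ(x) itself, and keep the
-- others, up to a renaming that leaves one variable fresh.  Two resulting
-- formulas of L then share a variable only if their σ-images do, so that the
-- hypotheses on 𝓢 apply, and σ factors through this replacement.
module Submission where

open import Defs
open import Level using (Level; Lift; lift; lower; suc)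
open import Axiom.ExcludedMiddle using (ExcludedMiddle)
open import Data.Bool.Base using (Bool; T)
open import Data.Nat.Base using (ℕ)
import Data.Nat.Base as ℕ
open import Data.Nat.Properties using (suc-injective)
open import Data.Product using (Σ-syntax; ∃-syntax; _×_; _,_; proj₁; proj₂)
open import Data.Sum.Base using (inj₁; inj₂)
open import Data.Vec.Base as Vec using (Vec; []; _∷_)
open import Data.Vec.Properties using (map-∘; map-id)
open import Data.Vec.Relation.Unary.Any using (Any; here; there)
open import Function.Base using (_∘_; id)
open import Function.Bundles
  using (_↣_; _⇔_; mk⇔; mk↣; module Injection; module Equivalence)
open import Relation.Binary.PropositionalEquality
  using (_≡_; refl; sym; trans; cong; cong₂; subst)
open import Relation.Nullary using (¬_; yes; no; contradiction)
open import Relation.Nullary.Decidable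
  using (True; toWitness; fromWitness; ⌊_⌋)
open import Relation.Unary using (_∈_; _∉_; _⊆_; _∪_; _∩_; _⊥_; ∁; ⋃; Universal)

open Injection using (to)

-- Valuations, substitutions and occurrences of variables.

module _ {ℓ : Level} {Sg : Signature ℓ} where

  private
    variable
      V W : Set ℓ
      𝑨 : Algebra Sg

  Lang : Set ℓ → Language ℓ
  Lang V = record { signature = Sg ; Var = V }

  Subst : Set ℓ → Set ℓ → Set ℓ
  Subst V W = Valuation (Lang V) (formulaAlgebra (Lang W))

  idSubst : Subst V V
  idSubst = record
    { ⟨_⟩ = id ; const-homo = λ _ → refl
    ; conn-homo = λ f ts → cong (conn f) (sym (map-id ts)) }

  infixr 9 _⊙_

  _⊙_ : Valuation (Lang W) 𝑨 → Subst V W → Valuation (Lang V) 𝑨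
  _⊙_ {𝑨 = 𝑨} v σ = record
    { ⟨_⟩        = ⟨ v ⟩ ∘ ⟨ σ ⟩
    ; const-homo = λ c → trans (cong ⟨ v ⟩ (σ.const-homo c)) (v.const-homo c)
    ; conn-homo  = λ f ts → trans (cong ⟨ v ⟩ (σ.conn-homo f ts))
        (trans (v.conn-homo f _) (cong (Algebra.⟦conn⟧ 𝑨 f) (sym (map-∘ _ _ ts))))
    }
    where
    module v = Valuation v
    module σ = Valuation σ

  module _ (𝑨 : Algebra Sg) (e : V → Carrier 𝑨) where
    open Algebra 𝑨 using (⟦const⟧; ⟦conn⟧)

    eval  : Fm (Lang V) → Carrier 𝑨
    evals : ∀ {n} → Vec (Fm (Lang V)) n → Vec (Carrier 𝑨) n
    eval (var x)     = e x
    eval (const c)   = ⟦const⟧ c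
    eval (conn f ts) = ⟦conn⟧ f (evals ts)
    evals []         = []
    evals (t ∷ ts)   = eval t ∷ evals ts

    evals≡map : ∀ {n} (ts : Vec (Fm (Lang V)) n) → evals ts ≡ Vec.map eval ts
    evals≡map []       = refl
    evals≡map (t ∷ ts) = cong (eval t ∷_) (evals≡map ts)

    valuation : Valuation (Lang V) 𝑨
    valuation = record
      { ⟨_⟩ = eval ; const-homo = λ _ → refl
      ; conn-homo = λ f ts → cong (⟦conn⟧ f) (evals≡map ts) }

  substitution : (V → Fm (Lang W)) → Subst V W
  substitution = valuation (formulaAlgebra (Lang _))

  module _ (v w : Valuation (Lang V) 𝑨) where
    private
      module v = Valuation v
      module w = Valuation w

    -- Only occurring variables count, so the hypothesis is vacuous for variable-free formulas and
    -- blind to changes at a variable foreign to `α`.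
    agree : ∀ α → (∀ {x} → x occursIn α → ⟨ v ⟩ (var x) ≡ ⟨ w ⟩ (var x)) →
            ⟨ v ⟩ α ≡ ⟨ w ⟩ α
    agrees : ∀ {n} (ts : Vec (Fm (Lang V)) n) →
             (∀ {x} → Any (x occursIn_) ts → ⟨ v ⟩ (var x) ≡ ⟨ w ⟩ (var x)) →
             Vec.map ⟨ v ⟩ ts ≡ Vec.map ⟨ w ⟩ ts
    agree (var x)     h = h here
    agree (const c)   h = trans (v.const-homo c) (sym (w.const-homo c))
    agree (conn f ts) h = trans (v.conn-homo f ts)
      (trans (cong (Algebra.⟦conn⟧ 𝑨 f) (agrees ts (h ∘ inside)))
             (sym (w.conn-homo f ts)))
    agrees []       h = refl
    agrees (t ∷ ts) h = cong₂ _∷_ (agree t (h ∘ here)) (agrees ts (h ∘ there))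

  module _ (σ : Subst V W) where
    private module σ = Valuation σ

    occursIn-subst⁺ : ∀ {x y} {α : Fm (Lang V)} → x occursIn α →
                      y occursIn ⟨ σ ⟩ (var x) → y occursIn ⟨ σ ⟩ α
    occursIn-substs⁺ : ∀ {x y n} {ts : Vec (Fm (Lang V)) n} →
                       Any (x occursIn_) ts → y occursIn ⟨ σ ⟩ (var x) →
                       Any (y occursIn_) (Vec.map ⟨ σ ⟩ ts)
    occursIn-subst⁺ here o = o
    occursIn-subst⁺ {y = y} (inside {f} {ts} p) o =
      subst (y occursIn_) (sym (σ.conn-homo f ts)) (inside (occursIn-substs⁺ p o))
    occursIn-substs⁺ (here p)  o = here (occursIn-subst⁺ p o)
    occursIn-substs⁺ (there p) o = there (occursIn-substs⁺ p o)

    occursIn-subst⁻ : ∀ {y} (α : Fm (Lang V)) → y occursIn ⟨ σ ⟩ α →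
                      ∃[ x ] (x occursIn α × y occursIn ⟨ σ ⟩ (var x))
    occursIn-substs⁻ : ∀ {y n} (ts : Vec (Fm (Lang V)) n) →
                       Any (y occursIn_) (Vec.map ⟨ σ ⟩ ts) →
                       ∃[ x ] (Any (x occursIn_) ts × y occursIn ⟨ σ ⟩ (var x))
    occursIn-subst⁻ (var x) o = x , here , o
    occursIn-subst⁻ {y} (const c) o
      with () ← subst (y occursIn_) (σ.const-homo c) o
    occursIn-subst⁻ {y} (conn f ts) o
      with inside p ← subst (y occursIn_) (σ.conn-homo f ts) o
      with x , q , r ← occursIn-substs⁻ ts p = x , inside q , r
    occursIn-substs⁻ (t ∷ ts) (here p)
      with x , q , r ← occursIn-subst⁻ t p = x , here q , r
    occursIn-substs⁻ (t ∷ ts) (there p)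
      with x , q , r ← occursIn-substs⁻ ts p = x , there q , r

    -- A substitution preserves an outermost constant or connective, so only a variable can become a
    -- variable.
    subst≡var : ∀ {w} (α : Fm (Lang V)) → ⟨ σ ⟩ α ≡ var w → ∃[ x ] α ≡ var x
    subst≡var (var x) _ = x , refl
    subst≡var (const c) eq with () ← trans (sym (σ.const-homo c)) eq
    subst≡var (conn f ts) eq with () ← trans (sym (σ.conn-homo f ts)) eq

-- Tools from excluded middle: extension, shift, resizing.

module Classical (em : ∀ {a : Level} → ExcludedMiddle a) where

  module _ {a b c} {A : Set a} {B : Set b} {C : Set c}
           (f : A ↣ B) (g : A → C) (d : C) where

    extendAlong : B → C
    extendAlong y with em {P = ∃[ x ] to f x ≡ y}
    ... | yes (x , _) = g x
    ... | no  _       = d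

    extendAlong-to : ∀ x → extendAlong (to f x) ≡ g x
    extendAlong-to x with em {P = ∃[ x′ ] to f x′ ≡ to f x}
    ... | yes (_ , eq) = cong g (Injection.injective f eq)
    ... | no  ∄        = contradiction (x , refl) ∄

    extendAlong-∉ : ∀ {y} → ¬ (∃[ x ] to f x ≡ y) → extendAlong y ≡ d
    extendAlong-∉ {y} ∄ with em {P = ∃[ x ] to f x ≡ y}
    ... | yes p = contradiction p ∄
    ... | no  _ = refl

  module _ {a} {A : Set a} (f : ℕ ↣ A) where

    -- Hilbert's hotel: moving the copy of `ℕ` up by one vacates `to f 0`.
    shift : A → A
    shift x with em {P = ∃[ n ] to f n ≡ x}
    ... | yes (n , _) = to f (ℕ.suc n)
    ... | no  _       = x

    shift-injective : ∀ {x y} → shift x ≡ shift y → x ≡ y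
    shift-injective {x} {y} eq
      with em {P = ∃[ n ] to f n ≡ x} | em {P = ∃[ n ] to f n ≡ y}
    ... | yes (n , refl) | yes (m , refl) =
      cong (to f) (suc-injective (Injection.injective f eq))
    ... | yes _ | no ∄  = contradiction (_ , eq) ∄
    ... | no ∄  | yes _ = contradiction (_ , sym eq) ∄
    ... | no _  | no _  = eq

    shift-misses-0 : ¬ (∃[ x ] shift x ≡ to f 0)
    shift-misses-0 (x , eq) with em {P = ∃[ n ] to f n ≡ x}
    ... | yes (n , _) with () ← Injection.injective f eq
    ... | no ∄ = ∄ (0 , sym eq)

  -- Consequence lives at level `suc ℓ`, logical filters at `ℓ`; a decided proposition fits at any
  -- level.
  resize : ∀ {ℓ a} → Set a → Set ℓ
  resize {ℓ} P = Lift ℓ (True (em {P = P}))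

  ∃∉ : ∀ {a p} {A : Set a} {P : A → Set p} → ¬ Universal P → ∃[ x ] x ∉ P
  ∃∉ {P = P} ¬∀ with em {P = ∃[ x ] x ∉ P}
  ... | yes p = p
  ... | no ∄  = contradiction (λ x → all x) ¬∀
    where
    all : Universal P
    all x with em {P = P x}
    ... | yes px = px
    ... | no ¬px = contradiction (x , ¬px) ∄

  -- Atlases whose sets in `𝔖` are the theories of a logic.

  module Adequacy {ℓ} {L : Language ℓ} (𝓢 : AbstractLogic L)
                  (𝔸 : Atlas (signature L)) where

    open AbstractLogic 𝓢
    open Atlas 𝔸

    record Adequate : Set (suc ℓ) where
      field
        closed : ∀ {i Z α} → Z ∈ 𝔖 L 𝔸 i → Z ⊢ α → α ∈ Z
        theory : ∀ X → Σ[ i ∈ I ] Σ[ Z ∈ 𝒫Fm L ]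
                   (Z ∈ 𝔖 L 𝔸 i × (∀ {α} → α ∈ Z ⇔ X ⊢ α))

    module _ (adequate : Adequate) where
      open Adequate adequate

      determines : Determines L 𝔸 𝓢
      determines X α = mk⇔ sound complete
        where
        sound : X ⊢ α → _⊨_ L 𝔸 X α
        sound X⊢α i v vX⊆D =
          closed (v , id , id) (monotone (λ x → vX⊆D (_ , x , refl)) X⊢α)
        complete : _⊨_ L 𝔸 X α → X ⊢ α
        complete X⊨α with theory X
        ... | i , Z , (v , Z⊆ , Z⊇) , Z⇔ = Equivalence.to Z⇔ (Z⊇ (X⊨α i v
          λ { (_ , x , refl) → Z⊆ (Equivalence.from Z⇔ (reflexive x)) }))

      -- `Zₖ` is the theory generated by the traces `A` and `B`. Uniformity discards `B` from a
      -- derivation of a formula without variables of `Y`, which puts that formula into `Zᵢ`.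
      uniformAtlas : Uniform 𝓢 → UniformAtlas L 𝔸
      uniformAtlas uniform X Y X⊆ i j Zᵢ Zⱼ Zᵢ∈ Zⱼ∈
        with theory ((Zᵢ ∩ Fm[ ∁ (𝒱 Y) ]) ∪ (Zⱼ ∩ Fm[ 𝒱 Y ]))
      ... | k , Zₖ , Zₖ∈ , Zₖ⇔ = k , Zₖ , Zₖ∈ , λ _ _ (_ , Zⱼ⊉U) →
          ( (λ a → Equivalence.from Zₖ⇔ (reflexive (inj₁ a)) , λ {x} → proj₂ a {x})
          , (λ (z , α-free) → closed Zᵢ∈ (monotone proj₁ (uniform A B _
               (λ { ((_ , inj₁ (_ , free) , p) , _ , (_ , inY) , q) → free p (inY q)
                  ; ((_ , inj₂ refl , p) , _ , (_ , inY) , q) → α-free p (inY q) })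
               -- If `B` were inconsistent, the theory `Zⱼ` around it would contain every formula.
               (λ incons → Zⱼ⊉U (λ {γ} _ → closed Zⱼ∈ (monotone proj₁ (incons γ))))
               (Equivalence.to Zₖ⇔ z)))
             , λ {x} → α-free {x}))
          , λ b → Equivalence.from Zₖ⇔ (reflexive (inj₂ b))
        where
        A B : 𝒫Fm L
        A = Zᵢ ∩ Fm[ ∁ (𝒱 Y) ]
        B = Zⱼ ∩ Fm[ 𝒱 Y ]

      -- The theory of the union is the witness. Were it improper, couniformity would make some
      -- `X t` inconsistent, although a proper theory contains it.
      couniformAtlas : Couniform 𝓢 → CouniformAtlas L 𝔸
      couniformAtlas couniform T X disjoint proper models
        with em {P = Inconsistent 𝓢 (⋃ T X)}
      ... | yes incons with couniform T X disjoint proper incons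
      ...   | t , inconsₜ with models t
      ...     | j , Z , Z∈ , X⊆Z , _ , Z⊉U =
        contradiction (λ {γ} _ → closed Z∈ (monotone X⊆Z (inconsₜ γ))) Z⊉U
      couniformAtlas couniform T X disjoint proper models
          | no cons with theory (⋃ T X)
      ...   | k , Z , Z∈ , Z⇔ = k , Z , Z∈
        , (λ x → Equivalence.from Z⇔ (reflexive x))
        , _ , λ U⊆Z → cons (λ γ → Equivalence.to Z⇔ (U⊆Z _))

  open Adequacy using (Adequate)

  -- The Lindenbaum atlas.

  module _ {ℓ} {Sg : Signature ℓ} {W : Set ℓ} (𝓢⁺ : AbstractLogic (Lang {Sg = Sg} W)) where

    open AbstractLogic 𝓢⁺ renaming (_⊢_ to _⊢⁺_)

    private
      ⟦_⟧ : (Fm (Lang {Sg = Sg} W) → Bool) → 𝒫Fm (Lang W)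
      ⟦ b ⟧ α = Lift ℓ (T (b α))

    -- Subsets of formulas are too large to index an atlas; by excluded middle
    -- the Boolean predicates represent them all.
    lindenbaum : Atlas Sg
    lindenbaum = record
      { algebra   = formulaAlgebra (Lang W)
      ; I         = Fm (Lang W) → Bool
      ; inhabited = λ _ → Bool.true
      ; D         = λ b α → resize (⟦ b ⟧ ⊢⁺ α)
      }

    -- The theory of `X` is the preimage under `σ` of the theory of its image. Keeping `σ` as a
    -- parameter covers both the embedding of L and the identity on L⁺.
    lindenbaum-adequate : ∀ {V} (𝓢 : AbstractLogic (Lang {Sg = Sg} V)) →
      let open AbstractLogic 𝓢 using (_⊢_) in
      (∀ (σ : Subst V W) {X α} → X ⊢ α → image ⟨ σ ⟩ X ⊢⁺ ⟨ σ ⟩ α) →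
      (σ : Subst V W) →
      (∀ {X α} → image ⟨ σ ⟩ X ⊢⁺ ⟨ σ ⟩ α → X ⊢ α) →
      Adequate 𝓢 lindenbaum
    lindenbaum-adequate 𝓢 preserves σ reflects = record
      { closed = λ { {i = b} (v , Z⊆ , Z⊇) Z⊢α → Z⊇ (lift (fromWitness
          -- The image of `Z` consists of consequences of `⟦ b ⟧`, so cut removes it.
          (cut {Y = image ⟨ v ⟩ _}
            (λ { (_ , z , refl) → toWitness (lower (Z⊆ z)) })
            (monotone inj₂ (preserves v Z⊢α))))) }
      ; theory = λ X →
          let b = λ α → ⌊ em {P = α ∈ image ⟨ σ ⟩ X} ⌋ in
          b , (λ α → resize (⟦ b ⟧ ⊢⁺ ⟨ σ ⟩ α)) , (σ , id , id) ,
          mk⇔ (λ z → reflects (monotone (toWitness ∘ lower) (toWitness (lower z))))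
              (λ X⊢α → lift (fromWitness
                (monotone (lift ∘ fromWitness) (preserves σ X⊢α))))
      }

  -- Separation of variables.

  -- For σ : Subst V W this is the replacement τ of the header; `restore δ` is
  -- the factorisation of σ through τ which sends the fresh variable to δ.
  module Separation {ℓ} {Sg : Signature ℓ} {V W : Set ℓ} (infinite : ℕ ↣ V)
                    (σ : Subst {Sg = Sg} V W) where

    fresh : V
    fresh = to infinite 0

    private
      -- Applied only to variable-free formulas, it merely moves them to the other language; the
      -- value `var fresh` is arbitrary.
      ground : Subst {Sg = Sg} W V
      ground = substitution (λ _ → var fresh)

      π : V ↣ V
      π = mk↣ (shift-injective infinite)

      τ₀ : V → Fm (Lang V)
      τ₀ x with em {P = ∃[ w ] w occursIn ⟨ σ ⟩ (var x)}
      ... | yes _ = var (to π x)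
      ... | no  _ = ⟨ ground ⟩ (⟨ σ ⟩ (var x))

      occursIn-τ₀ : ∀ {x y} → y occursIn τ₀ x →
                    y ≡ to π x × ∃[ w ] w occursIn ⟨ σ ⟩ (var x)
      occursIn-τ₀ {x} o with em {P = ∃[ w ] w occursIn ⟨ σ ⟩ (var x)}
      occursIn-τ₀ here | yes ∃w = refl , ∃w
      ... | no ∄w with w , p , _ ← occursIn-subst⁻ ground (⟨ σ ⟩ (var x)) o =
        contradiction (w , p) ∄w

    τ : Subst {Sg = Sg} V V
    τ = substitution τ₀

    restore : Fm (Lang W) → Subst {Sg = Sg} V W
    restore δ = substitution (extendAlong π (⟨ σ ⟩ ∘ var) δ)

    restore-fresh : ∀ δ → ⟨ restore δ ⟩ (var fresh) ≡ δ
    restore-fresh δ = extendAlong-∉ π _ δ (shift-misses-0 infinite)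

    -- Extension along `π` undoes the renaming, variable-free formulas stay as they are, and `δ`
    -- never enters because `π` misses `fresh`.
    restore-τ : ∀ δ α → ⟨ restore δ ⟩ (⟨ τ ⟩ α) ≡ ⟨ σ ⟩ α
    restore-τ δ α = agree (restore δ ⊙ τ) σ α λ {x} _ → restore-τ₀ x
      where
      restore-τ₀ : ∀ x → ⟨ restore δ ⟩ (τ₀ x) ≡ ⟨ σ ⟩ (var x)
      restore-τ₀ x with em {P = ∃[ w ] w occursIn ⟨ σ ⟩ (var x)}
      ... | yes _ = extendAlong-to π _ δ x
      ... | no ∄w = agree (restore δ ⊙ ground) idSubst (⟨ σ ⟩ (var x))
                      (λ p → contradiction (_ , p) ∄w)

    fresh-∉-τ : ∀ α → ¬ (fresh occursIn ⟨ τ ⟩ α)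
    fresh-∉-τ α o with x , _ , q ← occursIn-subst⁻ τ α o =
      shift-misses-0 infinite (x , sym (proj₁ (occursIn-τ₀ q)))

    separated : ∀ {y} α β → y occursIn ⟨ τ ⟩ α → y occursIn ⟨ τ ⟩ β →
                ∃[ w ] (w occursIn ⟨ σ ⟩ α × w occursIn ⟨ σ ⟩ β)
    separated α β o o′
      with x  , p  , q  ← occursIn-subst⁻ τ α o
      with x′ , p′ , q′ ← occursIn-subst⁻ τ β o′
      with y≡  , w , r ← occursIn-τ₀ q
      with y≡′ , _     ← occursIn-τ₀ q′
      -- The shared variable is both `π x` and `π x′`, so `x` and `x′` coincide and each variable of
      -- `σ(x)` is common to both images.
      with refl ← shift-injective infinite (trans (sym y≡) y≡′)
      = w , occursIn-subst⁺ σ p r , occursIn-subst⁺ σ p′ r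

  -- Fresh variables and inconsistency.

  module _ {ℓ} {L : Language ℓ} (𝓢 : AbstractLogic L) (structural : Structural 𝓢) where

    open AbstractLogic 𝓢

    -- Substituting any `γ` for `x` leaves `X` unchanged, so structurality turns the derivation of
    -- `x` into one of `γ`.
    derives-fresh⇒inconsistent : ∀ {X : 𝒫Fm L} {x} → x ∉ 𝒱 X → X ⊢ var x → Inconsistent 𝓢 X
    derives-fresh⇒inconsistent {X} {x} x∉ X⊢x γ =
      monotone (λ { (α , α∈X , refl) → subst (_∈ X) (sym (fixes α α∈X)) α∈X })
        (subst (image ⟨ σ ⟩ X ⊢_) σx≡γ (structural σ X⊢x))
      where
      e : Var L → Fm L
      e y with em {P = y ≡ x}
      ... | yes _ = γ
      ... | no  _ = var y
      σ : Substitution L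
      σ = substitution e
      σx≡γ : e x ≡ γ
      σx≡γ with em {P = x ≡ x}
      ... | yes _ = refl
      ... | no x≢x = contradiction refl x≢x
      e-≢ : ∀ y → ¬ (y ≡ x) → e y ≡ var y
      e-≢ y y≢x with em {P = y ≡ x}
      ... | yes y≡x = contradiction y≡x y≢x
      ... | no _ = refl
      fixes : ∀ α → α ∈ X → ⟨ σ ⟩ α ≡ α
      fixes α α∈X = agree σ idSubst α
        (λ {y} p → e-≢ y (λ { refl → x∉ (α , α∈X , p) }))

  -- The Wójcicki logic over `𝓢`.

  module Wójcicki {ℓ} {L : Language ℓ} (𝓢 : AbstractLogic L) (structural : Structural 𝓢)
                  (infinite : ℕ ↣ Var L) (E : PrimitiveExtension L)
                  (𝓢⁺ : AbstractLogic (PrimitiveExtension.language E))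
                  (isWójcicki : IsWójcickiLogic 𝓢 E 𝓢⁺) where

    open PrimitiveExtension E renaming (language to L⁺)
    open AbstractLogic 𝓢
    open AbstractLogic 𝓢⁺ using () renaming (_⊢_ to _⊢⁺_; monotone to monotone⁺)

    embeds≡map : ∀ {n} (ts : Vec (Fm L) n) → embeds ts ≡ Vec.map embed ts
    embeds≡map []       = refl
    embeds≡map (t ∷ ts) = cong (embed t ∷_) (embeds≡map ts)

    embedding : Subst (Var L) Var⁺
    embedding = record
      { ⟨_⟩ = embed ; const-homo = λ _ → refl
      ; conn-homo = λ f ts → cong (conn f) (embeds≡map ts) }

    -- The Wójcicki relation admits only L⁺-substitutions after `embed`. Extending along `include`,
    -- with an arbitrary value off the image, makes `σ` one of these.
    translates : ∀ (σ : Subst (Var L) Var⁺) {X α} → X ⊢ α → image ⟨ σ ⟩ X ⊢⁺ ⟨ σ ⟩ α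
    translates σ {X} {α} X⊢α = Equivalence.from (isWójcicki _ _)
      (X , α , σ⁺
      , (λ { (γ , γ∈X , refl) → γ , γ∈X , σ⁺-embed γ })
      , sym (σ⁺-embed α) , X⊢α)
      where
      e : Var⁺ → Fm L⁺
      e = extendAlong include (⟨ σ ⟩ ∘ var) (⟨ σ ⟩ (var (to infinite 0)))
      σ⁺ : Substitution L⁺
      σ⁺ = substitution e
      σ⁺-embed : ∀ γ → ⟨ σ⁺ ⟩ (embed γ) ≡ ⟨ σ ⟩ γ
      σ⁺-embed γ = agree (σ⁺ ⊙ embedding) σ γ (λ {x} _ → extendAlong-to include _ _ x)

    translates-into : ∀ (σ : Subst (Var L) Var⁺) {X Y α} →
                      (∀ γ → γ ∈ X → ⟨ σ ⟩ γ ∈ Y) → X ⊢ α → Y ⊢⁺ ⟨ σ ⟩ α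
    translates-into σ X⊆ X⊢α =
      monotone⁺ (λ { (γ , γ∈X , refl) → X⊆ γ γ∈X }) (translates σ X⊢α)

    record Derivation (X : 𝒫Fm L⁺) (α : Fm L⁺) : Set (suc ℓ) where
      field
        Z       : 𝒫Fm L
        β       : Fm L
        σ       : Subst (Var L) Var⁺
        σZ⊆X    : ∀ γ → γ ∈ Z → ⟨ σ ⟩ γ ∈ X
        σβ≡α    : ⟨ σ ⟩ β ≡ α
        derives : Z ⊢ β

    derivation : ∀ {X α} → X ⊢⁺ α → Derivation X α
    derivation X⊢α with Equivalence.to (isWójcicki _ _) X⊢α
    ... | Z , β , σ , Z⊆X , α≡ , Z⊢β = record
      { Z = Z ; β = β ; σ = σ ⊙ embedding
      ; σZ⊆X = λ γ γ∈Z → Z⊆X (γ , γ∈Z , refl)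
      ; σβ≡α = sym α≡ ; derives = Z⊢β }

    structural⁺ : Structural 𝓢⁺
    structural⁺ v X⊢α with derivation X⊢α
    ... | record { σ = σ ; σZ⊆X = σZ⊆X ; σβ≡α = refl ; derives = Z⊢β } =
      translates-into (v ⊙ σ) (λ γ γ∈Z → _ , σZ⊆X γ γ∈Z , refl) Z⊢β

    -- `ρ` retracts L⁺ onto L, so `ρ ⊙ σ` is a substitution of L; it carries the witness `Z ⊢ β` to
    -- a derivation of `α` from premises in `X`.
    conservative : ∀ {X α} → image embed X ⊢⁺ embed α → X ⊢ α
    conservative {X} {α} embedX⊢ with derivation embedX⊢
    ... | record { Z = Z ; σ = σ ; σZ⊆X = σZ⊆X ; σβ≡α = σβ≡α ; derives = Z⊢β } =
      subst (X ⊢_) (trans (cong ⟨ ρ ⟩ σβ≡α) (ρ-embed α))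
        (monotone (λ { (γ , γ∈Z , refl) → ρσ∈X γ γ∈Z }) (structural (ρ ⊙ σ) Z⊢β))
      where
      ρ : Subst Var⁺ (Var L)
      ρ = substitution (extendAlong include var (var (to infinite 0)))
      ρ-embed : ∀ γ → ⟨ ρ ⟩ (embed γ) ≡ γ
      ρ-embed γ = agree (ρ ⊙ embedding) idSubst γ (λ {x} _ → extendAlong-to include _ _ x)
      ρσ∈X : ∀ γ → γ ∈ Z → ⟨ ρ ⟩ (⟨ σ ⟩ γ) ∈ X
      ρσ∈X γ γ∈Z with ξ , ξ∈X , eq ← σZ⊆X γ γ∈Z =
        subst (_∈ X) (sym (trans (cong ⟨ ρ ⟩ eq) (ρ-embed ξ))) ξ∈X

    -- Transfer of uniformity and couniformity.

    module Split (σ : Subst {Sg = signature L} (Var L) Var⁺) (Z : 𝒫Fm L) where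
      open Separation infinite σ public

      part : 𝒫Fm L⁺ → 𝒫Fm L
      part X = image ⟨ τ ⟩ (λ γ → γ ∈ Z × ⟨ σ ⟩ γ ∈ X)

      restore-part : ∀ δ X γ → γ ∈ part X → ⟨ restore δ ⟩ γ ∈ X
      restore-part δ X _ (γ , (_ , σγ∈X) , refl) =
        subst (_∈ X) (sym (restore-τ δ γ)) σγ∈X

      -- A derivation of `fresh` suffices: `restore δ` sends `fresh` to the arbitrary `δ` while
      -- mapping `part X` into `X`.
      inconsistent-part : ∀ {X} → Inconsistent 𝓢 (part X) → Inconsistent 𝓢⁺ X
      inconsistent-part {X} incons δ = subst (X ⊢⁺_) (restore-fresh δ)
        (translates-into (restore δ) (restore-part δ X) (incons (var fresh)))

    -- Under `τ` the premises split into `part X` and `part Y`. Uniformity of `𝓢` removes the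
    -- latter, and `restore` carries the rest back to L⁺.
    uniform⁺ : Uniform 𝓢 → Uniform 𝓢⁺
    uniform⁺ uniform X Y α disjoint consistent X∪Y⊢α with derivation X∪Y⊢α
    ... | record { Z = Z ; β = β ; σ = σ ; σZ⊆X = σZ⊆ ; σβ≡α = refl ; derives = Z⊢β } =
      subst (X ⊢⁺_) (restore-τ (⟨ σ ⟩ β) β)
        (translates-into (restore (⟨ σ ⟩ β)) (restore-part (⟨ σ ⟩ β) X)
          (uniform (part X) (part Y) (⟨ τ ⟩ β) disjoint′
            (consistent ∘ inconsistent-part)
            (monotone cover (structural τ Z⊢β))))
      where
      open Split σ Z
      cover : image ⟨ τ ⟩ Z ⊆ part X ∪ part Y
      cover (γ , γ∈Z , refl) with σZ⊆ γ γ∈Z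
      ... | inj₁ σγ∈X = inj₁ (γ , (γ∈Z , σγ∈X) , refl)
      ... | inj₂ σγ∈Y = inj₂ (γ , (γ∈Z , σγ∈Y) , refl)
      disjoint′ : 𝒱 (part X ∪ (⟨ τ ⟩ β ≡_)) ⊥ 𝒱 (part Y)
      disjoint′ ((_ , inj₁ (γ , (_ , σγ∈X) , refl) , o) , _ , (γ′ , (_ , σγ′∈Y) , refl) , o′)
        with w , p , p′ ← separated γ γ′ o o′ =
        disjoint ((_ , inj₁ σγ∈X , p) , _ , σγ′∈Y , p′)
      disjoint′ ((_ , inj₂ refl , o) , _ , (γ′ , (_ , σγ′∈Y) , refl) , o′)
        with w , p , p′ ← separated β γ′ o o′ =
        disjoint ((_ , inj₂ refl , p) , _ , σγ′∈Y , p′)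

    -- One derivation is enough, that of a variable `w` foreign to all `X t`: it makes the `τ`-image
    -- of `Z` inconsistent, and couniformity of `𝓢` passes this to some part.
    couniform⁺ : Couniform 𝓢 → Couniform 𝓢⁺
    couniform⁺ couniform T X disjoint proper inconsistent
      with w , w∉ ← ∃∉ proper
      with record { Z = Z ; β = β ; σ = σ ; σZ⊆X = σZ⊆ ; σβ≡α = σβ≡w ; derives = Z⊢β }
             ← derivation (inconsistent (var w))
      = let t , inconsₜ = couniform T (part ∘ X) disjoint′
              -- No part contains `fresh`, so the parts do not exhaust the variables of L.
              (λ all → let _ , (_ , γ , _ , eq) , o = all fresh in
                 fresh-∉-τ γ (subst (fresh occursIn_) eq o))
              (λ γ → monotone cover (τZ-inconsistent γ))
        in t , inconsistent-part inconsₜ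
      where
      open Split σ Z
      cover : image ⟨ τ ⟩ Z ⊆ ⋃ T (part ∘ X)
      cover (γ , γ∈Z , refl) with t , σγ∈X ← σZ⊆ γ γ∈Z = t , γ , (γ∈Z , σγ∈X) , refl
      disjoint′ : ∀ t t′ → ¬ (t ≡ t′) → 𝒱 (part (X t)) ⊥ 𝒱 (part (X t′))
      disjoint′ t t′ t≢t′ ((_ , (γ , (_ , p) , refl) , o) , _ , (γ′ , (_ , p′) , refl) , o′)
        with w , q , q′ ← separated γ γ′ o o′ =
        disjoint t t′ t≢t′ ((_ , p , q) , _ , p′ , q′)
      -- As σ(β) is the variable w, so is τ(β) a variable; it is foreign to τ(Z)
      -- because w is foreign to σ(Z).
      τZ-inconsistent : Inconsistent 𝓢 (image ⟨ τ ⟩ Z)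
      τZ-inconsistent
        with y , τβ≡y ← subst≡var (restore (var w)) (⟨ τ ⟩ β)
                          (trans (restore-τ (var w) β) σβ≡w)
        = derives-fresh⇒inconsistent 𝓢 structural y∉
            (subst (image ⟨ τ ⟩ Z ⊢_) τβ≡y (structural τ Z⊢β))
        where
        y∉ : y ∉ 𝒱 (image ⟨ τ ⟩ Z)
        y∉ (_ , (γ , γ∈Z , refl) , o)
          with w′ , p , q ← separated β γ (subst (y occursIn_) (sym τβ≡y) here) o
          with here ← subst (w′ occursIn_) σβ≡w p
          = w∉ (_ , σZ⊆ γ γ∈Z , q)

    -- The common atlas.

    atlas : Atlas (signature L)
    atlas = lindenbaum 𝓢⁺

    adequate : Adequate 𝓢 atlas
    adequate = lindenbaum-adequate 𝓢⁺ 𝓢 translates embedding conservative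

    adequate⁺ : Adequate 𝓢⁺ atlas
    adequate⁺ = lindenbaum-adequate 𝓢⁺ 𝓢⁺ structural⁺ idSubst
      (monotone⁺ λ { (_ , x , refl) → x })

proposition4p3 : (∀ {a : Level} → ExcludedMiddle a) →
    {ℓ : Level} (L : Language ℓ) (𝓢 : AbstractLogic L) → Structural 𝓢 →
    Uniform 𝓢 → Couniform 𝓢 →
    ℕ ↣ Var L →
    (E : PrimitiveExtension L) (𝓢⁺ : AbstractLogic (PrimitiveExtension.language E)) →
    IsWójcickiLogic 𝓢 E 𝓢⁺ →
    Σ[ 𝔸 ∈ Atlas (signature L) ]
    (Determines L 𝔸 𝓢 × Determines (PrimitiveExtension.language E) 𝔸 𝓢⁺ ×
    UniformAtlas L 𝔸 × CouniformAtlas L 𝔸 ×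
    UniformAtlas (PrimitiveExtension.language E) 𝔸 ×
    CouniformAtlas (PrimitiveExtension.language E) 𝔸)
proposition4p3 em L 𝓢 structural uniform couniform infinite E 𝓢⁺ isWójcicki =
  atlas ,
  determines 𝓢 atlas adequate , determines 𝓢⁺ atlas adequate⁺ ,
  uniformAtlas 𝓢 atlas adequate uniform , couniformAtlas 𝓢 atlas adequate couniform ,
  uniformAtlas 𝓢⁺ atlas adequate⁺ (uniform⁺ uniform) ,
  couniformAtlas 𝓢⁺ atlas adequate⁺ (couniform⁺ couniform)
  where
  open Classical em
  open Adequacy
  open Wójcicki 𝓢 structural infinite E 𝓢⁺ isWójcicki
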